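{- Let $a,b$ be non-negative integers with $\gcd(a,b)=1$ and let $n = a^2+ab+b^2$. Then each positive factor of $n$ is a $\mathcal{B}$-number.
   Context: A $\mathcal{B}$-number is an integer that can be written as $x^2+xy+y^2$ with non-negative integers $x \ge y$. -}

module Defs where

open import Data.Nat using (ℕ; _+_; _*_; _^_; _≥_)
open import Data.Product using (_×_; ∃-syntax)
open import Relation.Binary.PropositionalEquality using (_≡_)

-- Such integers are never negative, so the predicate is stated on ℕ.
IsℬNumber : ℕ → Set
IsℬNumber m = ∃[ x ] ∃[ y ] (x ≥ y × m ≡ x ^ 2 + x * y + y ^ 2)

{-# OPTIONS --safe #-}

-- Bézout coefficients s, r with a s − b r = 1 complete (a, b) to a unimodular
-- matrix, whence (a² + ab + b²)(r² + rs + s²) = t² + t + 1 with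
-- t = ar + br + bs.  So every factor d of n satisfies d e = t² + t + 1 for
-- some e and t, that is, d X² + (2t + 1) X Y + e Y² has discriminant −3.
-- Reduction theory carries this form to X² + X Y + Y²: if d ≤ t, the
-- substitution X ↦ X − Y replaces t by t − d, symmetrically if e ≤ t, and if t
-- is smaller than both then (t + 1)² ≤ d e = t² + t + 1 forces t = 0 and
-- d = e = 1.  No entry ever becomes negative, so all of this happens in ℕ.
module Submission where

open import Defs
open import Data.Nat using (ℕ; zero; suc; _+_; _*_; _^_; _≤_; _<_; z<s)
open import Data.Nat.Divisibility using (_∣_; divides; m∣m*n; ∣m⇒∣m*n; ∣m+n∣m⇒∣n)
open import Data.Nat.GCD using (gcd; GCD; gcd-GCD; module Bézout)
open import Data.Nat.Induction using (<-wellFounded)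
open import Data.Nat.Properties
open import Data.Nat.Tactic.RingSolver using (solve-∀)
open import Data.Product using (_×_; _,_; ∃-syntax)
open import Data.Sum using (inj₁; inj₂)
open import Induction.WellFounded using (Acc; acc)
open import Relation.Binary.PropositionalEquality
  using (_≡_; refl; sym; trans; cong; subst; module ≡-Reasoning)
open import Relation.Nullary using (yes; no; contradiction)

norm : ℕ → ℕ → ℕ
norm x y = x * x + x * y + y * y

norm-comm : ∀ x y → norm x y ≡ norm y x
norm-comm = expanded
  where
  expanded : ∀ x y → x * x + x * y + y * y ≡ y * y + y * x + x * x
  expanded = solve-∀

norm-^2 : ∀ x y → norm x y ≡ x ^ 2 + x * y + y ^ 2
norm-^2 = unfolded
  where
  unfolded : ∀ x y → x * x + x * y + y * y ≡ x * (x * 1) + x * y + y * (y * 1)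
  unfolded = solve-∀

norm-isℬNumber : ∀ x y → IsℬNumber (norm x y)
norm-isℬNumber x y with ≤-total y x
... | inj₁ y≤x = x , y , y≤x , norm-^2 x y
... | inj₂ x≤y = y , x , x≤y , trans (norm-comm x y) (norm-^2 y x)

-- Substituting `p * X + r * Y` and `q * X + s * Y` into X² + X Y + Y² gives the middle coefficient
-- 2pr + ps + qr + 2qs, which is `2 * inner p q r s + 1` when `p * s ≡ 1 + q * r`.
inner : ℕ → ℕ → ℕ → ℕ → ℕ
inner p q r s = p * r + q * r + q * s

-- The form d X² + (2t + 1) X Y + e Y² is X² + X Y + Y² transformed by a matrix
-- of determinant 1 with entries in ℕ.
record Principal (d e t : ℕ) : Set where
  constructor principal
  field
    p q r s : ℕ
    det : p * s ≡ 1 + q * r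
    d≡  : d ≡ norm p q
    e≡  : e ≡ norm r s
    t≡  : t ≡ inner p q r s

-- Exchanging X and Y alone would give determinant -1; exchanging the two rows as well, which X² + X
-- Y + Y² permits, restores 1.
Principal-swap : ∀ {d e t} → Principal d e t → Principal e d t
Principal-swap (principal p q r s det refl refl refl) =
  principal s r q p
    (trans (*-comm s p) (trans det (cong suc (*-comm q r))))
    (norm-comm r s) (norm-comm p q) (inner-swap p q r s)
  where
  inner-swap : ∀ p q r s → p * r + q * r + q * s ≡ s * q + r * q + r * p
  inner-swap = solve-∀

-- The substitution X ↦ X + Y, which undoes a reduction step: it adds the column (p, q) of the
-- matrix to the column (r, s).
Principal-shear : ∀ {d e t} → Principal d e t →
  Principal d (e + (2 * t + 1 + d)) (t + d)
Principal-shear (principal p q r s det refl refl refl) =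
  principal p q (r + p) (s + q) det′ refl e′ (t′ p q r s)
  where
  open ≡-Reasoning

  det′ : p * (s + q) ≡ 1 + q * (r + p)
  det′ = begin
    p * (s + q)         ≡⟨ *-distribˡ-+ p s q ⟩
    p * s + p * q       ≡⟨ cong (_+ p * q) det ⟩
    1 + q * r + p * q   ≡⟨ regroup p q r ⟩
    1 + q * (r + p)     ∎
    where
    regroup : ∀ p q r → 1 + q * r + p * q ≡ 1 + q * (r + p)
    regroup = solve-∀

  t′ : ∀ p q r s → p * r + q * r + q * s + (p * p + p * q + q * q) ≡
       p * (r + p) + q * (r + p) + q * (s + q)
  t′ = solve-∀

  e′ : norm r s + (2 * inner p q r s + 1 + norm p q) ≡ norm (r + p) (s + q)
  -- The cross term of `norm` at the sum of the columns is 2(pr + qs) + qr + ps; `det` supplies its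
  -- `p * s` from the odd constant 1.
  e′ = begin
    norm r s + (2 * inner p q r s + 1 + norm p q)
      ≡⟨ isolate-det p q r s ⟩
    norm r s + norm p q + 2 * (p * r + q * s) + q * r + (1 + q * r)
      ≡⟨ cong (norm r s + norm p q + 2 * (p * r + q * s) + q * r +_) det ⟨
    norm r s + norm p q + 2 * (p * r + q * s) + q * r + p * s
      ≡⟨ polarise p q r s ⟩
    norm (r + p) (s + q) ∎
    where
    isolate-det : ∀ p q r s →
      r * r + r * s + s * s +
        (2 * (p * r + q * r + q * s) + 1 + (p * p + p * q + q * q)) ≡
      r * r + r * s + s * s + (p * p + p * q + q * q) +
        2 * (p * r + q * s) + q * r + (1 + q * r)
    isolate-det = solve-∀

    polarise : ∀ p q r s →
      r * r + r * s + s * s + (p * p + p * q + q * q) +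
        2 * (p * r + q * s) + q * r + p * s ≡
      (r + p) * (r + p) + (r + p) * (s + q) + (s + q) * (s + q)
    polarise = solve-∀

-- A determinant 1 substitution preserves the discriminant -3, so (2t + 1)² - 4 d e = -3 for the two
-- norms d and e.
norm-*-norm : ∀ p q r s → p * s ≡ 1 + q * r → let t = inner p q r s in
  norm p q * norm r s ≡ t * t + t + 1
norm-*-norm p q r s det = begin
  norm p q * norm r s
    ≡⟨ expand-product p q r s ⟩
  product-form (p * s)
    ≡⟨ cong product-form det ⟩
  product-form (1 + q * r)
    ≡⟨ forms-agree (p * r) (q * s) (q * r) ⟩
  square-form (1 + q * r)
    ≡⟨ cong square-form det ⟨
  square-form (p * s)
    ≡⟨ expand-square p q r s ⟨
  inner p q r s * inner p q r s + inner p q r s + 1 ∎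
  where
  open ≡-Reasoning

  -- The argument `x` holds the place of `p * s`. Once `det` replaces it, both sides are polynomials
  -- in pr, qs and qr, and agree identically.
  product-form square-form : ℕ → ℕ
  product-form x = (p * r) * (p * r) + (q * s) * (q * s) + (p * r + q * s) * (x + q * r)
    + x * x + (q * r) * (q * r) + x * (q * r)
  -- The term 2 (pr)(qs) of t² is written as 2 (ps)(qr).
  square-form x = (p * r) * (p * r) + (q * s) * (q * s) + 2 * (x * (q * r)) + (q * r) * (q * r)
    + 2 * (p * r + q * s) * (q * r) + (p * r + q * r + q * s) + 1

  expand-product : ∀ p q r s →
    (p * p + p * q + q * q) * (r * r + r * s + s * s) ≡
    (p * r) * (p * r) + (q * s) * (q * s) + (p * r + q * s) * (p * s + q * r)
      + (p * s) * (p * s) + (q * r) * (q * r) + p * s * (q * r)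
  expand-product = solve-∀

  forms-agree : ∀ A B u →
    A * A + B * B + (A + B) * (1 + u + u) + (1 + u) * (1 + u) + u * u + (1 + u) * u ≡
    A * A + B * B + 2 * ((1 + u) * u) + u * u + 2 * (A + B) * u + (A + u + B) + 1
  forms-agree = solve-∀

  expand-square : ∀ p q r s →
    (p * r + q * r + q * s) * (p * r + q * r + q * s) + (p * r + q * r + q * s) + 1 ≡
    (p * r) * (p * r) + (q * s) * (q * s) + 2 * (p * s * (q * r)) + (q * r) * (q * r)
      + 2 * (p * r + q * s) * (q * r) + (p * r + q * r + q * s) + 1
  expand-square = solve-∀

shift-middle : ∀ d t → (d + t) * (d + t) + (d + t) + 1 ≡
  d * (2 * t + 1 + d) + (t * t + t + 1)
shift-middle = solve-∀

-- As t′ = t - d is congruent to t modulo d, d still divides t′² + t′ + 1; e′ is the quotient.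
reduce-middle : ∀ {d e t} → d ≤ t → d * e ≡ t * t + t + 1 →
  ∃[ t′ ] ∃[ e′ ] (t′ < t × d * e′ ≡ t′ * t′ + t′ + 1 ×
    e ≡ e′ + (2 * t′ + 1 + d) × t ≡ t′ + d)
-- A positive `d` makes t′ strictly smaller than `t` and can be cancelled.
reduce-middle {zero} {_} {t} _ 0≡ = contradiction (sym 0≡) (m+1+n≢0 (t * t + t))
reduce-middle {d@(suc _)} {e} d≤t de≡ with m≤n⇒∃[o]m+o≡n d≤t
... | t′ , refl with ∣m+n∣m⇒∣n (subst (d ∣_) (trans de≡ (shift-middle d t′)) (m∣m*n e))
                                (m∣m*n (2 * t′ + 1 + d))
... | divides e′ eq =
  t′ , e′ , m<n+m t′ z<s , de′≡ , *-cancelˡ-≡ _ _ d de≡′ , +-comm d t′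
  where
  open ≡-Reasoning

  c : ℕ
  c = 2 * t′ + 1 + d

  de′≡ : d * e′ ≡ t′ * t′ + t′ + 1
  de′≡ = trans (*-comm d e′) (sym eq)

  de≡′ : d * e ≡ d * (e′ + c)
  de≡′ = begin
    d * e                                ≡⟨ de≡ ⟩
    (d + t′) * (d + t′) + (d + t′) + 1   ≡⟨ shift-middle d t′ ⟩
    d * c + (t′ * t′ + t′ + 1)           ≡⟨ cong (d * c +_) de′≡ ⟨
    d * c + d * e′                       ≡⟨ *-distribˡ-+ d c e′ ⟨
    d * (c + e′)                         ≡⟨ cong (d *_) (+-comm c e′) ⟩
    d * (e′ + c)                         ∎

reduced⇒t≡0 : ∀ {d e t} → t < d → t < e → d * e ≡ t * t + t + 1 → t ≡ 0
reduced⇒t≡0 {d} {e} {t} t<d t<e de≡ =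
  n≤0⇒n≡0 (+-cancelˡ-≤ (t * t + t + 1) t 0 (begin
    t * t + t + 1 + t   ≡⟨ square t ⟩
    suc t * suc t       ≤⟨ *-mono-≤ t<d t<e ⟩
    d * e               ≡⟨ de≡ ⟩
    t * t + t + 1       ≡⟨ +-identityʳ _ ⟨
    t * t + t + 1 + 0   ∎))
  where
  open ≤-Reasoning
  square : ∀ t → t * t + t + 1 + t ≡ (1 + t) * (1 + t)
  square = solve-∀

isPrincipal : ∀ {d e t} → d * e ≡ t * t + t + 1 → Principal d e t
isPrincipal = go (<-wellFounded _)
  where
  go : ∀ {d e t} → Acc _<_ t → d * e ≡ t * t + t + 1 → Principal d e t
  go {d} {e} {t} (acc rec) de≡ with d ≤? t | e ≤? t
  ... | yes d≤t | _ with reduce-middle d≤t de≡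
  ...   | _ , _ , t′<t , de′≡ , refl , refl =
    Principal-shear (go (rec t′<t) de′≡)
  go {d} {e} (acc rec) de≡ | no _ | yes e≤t
    with reduce-middle e≤t (trans (*-comm e d) de≡)
  ...   | _ , _ , t′<t , ed′≡ , refl , refl =
    Principal-swap (Principal-shear (go (rec t′<t) ed′≡))
  go {d} {e} (acc rec) de≡ | no d≰t | no e≰t
    with reduced⇒t≡0 (≰⇒> d≰t) (≰⇒> e≰t) de≡
  ...   | refl with m*n≡1⇒m≡1 d e de≡ | m*n≡1⇒n≡1 d e de≡
  -- The form is now X² + X Y + Y² itself, so the identity matrix serves.
  ...     | refl | refl = principal 1 0 0 1 refl refl refl refl

-- The form takes the value d at X = 1, Y = 0, which the matrix sends to its first column (p, q);
-- hence d is `norm p q`.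
factor-isℬNumber : ∀ {a b r s d} → a * s ≡ 1 + b * r → d ∣ norm a b → IsℬNumber d
factor-isℬNumber {a} {b} {r} {s} {d} det d∣n
  with ∣m⇒∣m*n (norm r s) d∣n
... | divides e eq
  with isPrincipal {d} {e} {inner a b r s}
         (trans (*-comm d e) (trans (sym eq) (norm-*-norm a b r s det)))
... | principal p q _ _ _ refl _ _ = norm-isℬNumber p q

theorem13 : (a b n : ℕ) → gcd a b ≡ 1 → n ≡ a ^ 2 + a * b + b ^ 2 →
    (d : ℕ) → 0 < d → d ∣ n → IsℬNumber d
theorem13 a b _ gcd≡1 refl d _ d∣n
  with Bézout.identity (subst (GCD a b) gcd≡1 (gcd-GCD a b))
... | Bézout.+- s r eq =
  factor-isℬNumber {a} {b} (trans (*-comm a s) (trans (sym eq) (cong suc (*-comm r b))))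
    (subst (d ∣_) (sym (norm-^2 a b)) d∣n)
-- Here `1 + s * a ≡ r * b`: the sign is opposite, so `a` and `b` trade places, and `norm` is
-- symmetric.
... | Bézout.-+ s r eq =
  factor-isℬNumber {b} {a} (trans (*-comm b r) (trans (sym eq) (cong suc (*-comm s a))))
    (subst (d ∣_) (trans (sym (norm-^2 a b)) (norm-comm a b)) d∣n)
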